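{- Let $G=(V,E)$ be an undirected graph with $n$ nodes and $m$ edges, positive edge weights $w:E\to\mathbb{R}^+$, a set of ``gray'' edges $E_g\subseteq E$, a source vertex $s\in V$, an error parameter $0<\epsilon<1$, and a positive integer $g$. Let $W=\max_{e\in E} w(e)$. Define $w'(u,v) = w(u,v) + \epsilon W g^{ -1}$ for gray edges and $w'(u,v)=w(u,v)$ otherwise, run Dijkstra's algorithm from $s$ with weight function $w'$, and output the resulting paths $P(s,t)$ for each $t\in V$. This procedure runs in $O(m+n\log n)$ time, and for every $t\in V$ such that an $s\leadsto t$ g-short path exists, the output path $P(s,t)$ has at most $5g/\epsilon$ gray edges and satisfies $w(P(s,t)) < w(P_g(s,t)) + \epsilon W$ for every $s\leadsto t$ path $P_g(s,t)$ with fewer than $g$ gray edges. That is, the procedure solves the weighted weak constrained single-source shortest paths problem with error.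
   Context: An $s \leadsto t$ path is called g-short if it has fewer than $g$ gray edges and is of the form $(s,s') \circ \pi_G(s',t') \circ (t',t)$, where $\circ$ denotes path concatenation and $\pi_G(s',t')$ is a shortest (minimum-weight) $s'\leadsto t'$ path in $G$. The weight $w(P)$ of a path is the sum of its edge weights. The weighted weak CSSSP problem with error asks, for each $t\in V$, for a path $P(s,t)$ on at most $5g/\epsilon$ gray edges such that, whenever an $s\leadsto t$ g-short path exists, $w(P(s,t)) < w(P_g(s,t))+\epsilon W$ for all $s\leadsto t$ paths $P_g(s,t)$ on fewer than $g$ gray edges (otherwise $P(s,t)$ may be arbitrary). Dijkstra's algorithm is assumed implemented with Fibonacci heaps. -}

module Defs where

open import Level using (Level; _⊔_; suc)
open import Algebra.Bundles using (CommutativeRing)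
open import Algebra.Structures using (IsCommutativeRing)
open import Data.Bool.Base using (if_then_else_)
open import Data.Fin.Base using (Fin)
open import Data.Fin.Properties using (_≟_)
open import Data.Fin.Subset using (Subset)
open import Data.List.Base as List using (List; []; _∷_; allFin)
open import Data.Maybe.Base as Maybe using (Maybe; just; nothing)
open import Data.Nat.Base as ℕ using (ℕ; zero)
open import Data.Nat.Logarithm using (⌊log₂_⌋)
open import Data.Product using (Σ; ∃; ∃₂; _×_; _,_; proj₂)
open import Data.Sum.Base using (_⊎_; inj₁; inj₂)
open import Data.Vec.Base as Vec using ()
open import Relation.Binary.Bundles using (StrictTotalOrder; TotalOrder; DecTotalOrder)
open import Relation.Binary.Core using (Rel)
open import Relation.Binary.PropositionalEquality using (_≡_; refl)
open import Relation.Binary.Structures using (IsStrictTotalOrder)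
import Relation.Binary.Properties.StrictTotalOrder as STO
open import Relation.Nullary using (¬_; does; yes; no)
import Algebra.Definitions.RawMonoid as RawMonoidDefs
import Data.List.Extrema as Extrema

private
  variable
    a ℓ₁ ℓ₂ h : Level
    A B : Set a
    n m : ℕ

------------------------------------------------------------------------
-- Weights are taken in an arbitrary ordered field, of which ℝ is an
-- instance.  Trichotomy (in IsStrictTotalOrder) makes comparison
-- available as a primitive, as on a real RAM.

record OrderedField (c ℓ₁ ℓ₂ : Level) : Set (suc (c ⊔ ℓ₁ ⊔ ℓ₂)) where
  infixl 7 _*_
  infixl 6 _+_
  infix  8 -_
  infix  9 _⁻¹
  infix  4 _≈_ _<_
  field
    Carrier            : Set c
    _≈_                : Rel Carrier ℓ₁
    _<_                : Rel Carrier ℓ₂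
    _+_ _*_            : Carrier → Carrier → Carrier
    -_ _⁻¹             : Carrier → Carrier
    0# 1#              : Carrier
    isCommutativeRing  : IsCommutativeRing _≈_ _+_ _*_ -_ 0# 1#
    isStrictTotalOrder : IsStrictTotalOrder _≈_ _<_
    0<1                : 0# < 1#
    +-monoʳ-<          : ∀ x {y z} → y < z → x + y < x + z
    *-pos              : ∀ {x y} → 0# < x → 0# < y → 0# < x * y
    -- The value of 0# ⁻¹ is unconstrained.
    ⁻¹-cong            : ∀ {x y} → x ≈ y → x ⁻¹ ≈ y ⁻¹
    ⁻¹-inverseʳ        : ∀ {x} → ¬ (x ≈ 0#) → x * x ⁻¹ ≈ 1#

  commutativeRing : CommutativeRing c ℓ₁
  commutativeRing = record { isCommutativeRing = isCommutativeRing }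

  strictTotalOrder : StrictTotalOrder c ℓ₁ ℓ₂
  strictTotalOrder = record { isStrictTotalOrder = isStrictTotalOrder }

  open IsStrictTotalOrder isStrictTotalOrder public using (_<?_)

  totalOrder : TotalOrder c ℓ₁ (ℓ₁ ⊔ ℓ₂)
  totalOrder = DecTotalOrder.totalOrder (STO.decTotalOrder strictTotalOrder)

  open TotalOrder totalOrder public using (_≤_)

  fromℕ : ℕ → Carrier
  fromℕ k = k · 1#
    where open RawMonoidDefs (CommutativeRing.+-rawMonoid commutativeRing)
            renaming (_×_ to _·_)

------------------------------------------------------------------------
-- Computations that count their elementary steps

record Timed (A : Set a) : Set a where
  constructor _costing_
  field
    value : A
    time  : ℕ

open Timed public

infix  2 _costing_
infixl 1 _>>=_

return : A → Timed A
return x = x costing 0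

_>>=_ : Timed A → (A → Timed B) → Timed B
(x costing k) >>= f = value (f x) costing k ℕ.+ time (f x)

-- One elementary operation: an arithmetic operation, a comparison, a
-- memory access, or the allocation of one cell.
step : A → Timed A
step x = x costing 1

-- Each iteration is charged one step on top of the cost of the body.
for_from_do′_ : List A → B → (B → A → Timed B) → Timed B
for []       from acc do′ body = return acc
for (x ∷ xs) from acc do′ body =
  step acc >>= λ acc → body acc x >>= λ acc → for xs from acc do′ body

-- Arrays of length n, accessed in unit time.  Every array is used
-- linearly, so `write` may be read as an in-place update.
Array : (Fin n → Set a) → Set a
Array B = ∀ i → B i

_[_]≔_ : {B : Fin n → Set a} → Array B → (i : Fin n) → B i → Array B
(arr [ i ]≔ x) j with i ≟ j
... | yes refl = x
... | no  _    = arr j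

new : {B : Fin n → Set a} → (∀ i → B i) → Timed (Array B)
new {n = n} f = f costing n

read : {B : Fin n → Set a} → Array B → (i : Fin n) → Timed (B i)
read arr i = step (arr i)

write : {B : Fin n → Set a} → Array B → (i : Fin n) → B i → Timed (Array B)
write arr i x = step (arr [ i ]≔ x)

------------------------------------------------------------------------
-- Undirected graphs with vertices Fin n and edges Fin m, given as an
-- array of edges.  The order of the two ends is immaterial (see Joins).
-- Parallel edges and loops are not excluded.

Graph : ℕ → ℕ → Set
Graph n m = Fin m → Fin n × Fin n

Joins : Graph n m → Fin m → Fin n → Fin n → Set
Joins G e u v = G e ≡ (u , v) ⊎ G e ≡ (v , u)

-- Paths may repeat vertices.  They grow at the end, so that a path can
-- be extended by an edge in one step while sharing the old path.
data Path (G : Graph n m) (s : Fin n) : Fin n → Set where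
  []   : Path G s s
  _▷_  : ∀ {u v} → Path G s u → ∃ (λ e → Joins G e u v) → Path G s v

infixl 5 _▷_

module _ {G : Graph n m} where

  infixl 5 _∘_

  _∘_ : ∀ {u v t} → Path G u v → Path G v t → Path G u t
  P ∘ []      = P
  P ∘ (Q ▷ e) = (P ∘ Q) ▷ e

  edge : ∀ {u v} → ∃ (λ e → Joins G e u v) → Path G u v
  edge e = [] ▷ e

  grayEdges : Subset m → ∀ {u v} → Path G u v → ℕ
  grayEdges gray []            = 0
  grayEdges gray (P ▷ (e , _)) =
    grayEdges gray P ℕ.+ (if Vec.lookup gray e then 1 else 0)

Incident : Graph n m → Fin n → Set
Incident {m = m} G u = Σ (Fin m) λ e → ∃ λ v → Joins G e u v

buildAdjacency : (G : Graph n m) → Timed (Array λ u → List (Incident G u))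
buildAdjacency {m = m} G = do
  adj ← new (λ _ → [])
  for allFin m from adj do′ λ adj e → do
    (u , v) , uv ← step (G e , refl {x = G e})
    us  ← read adj u
    adj ← write adj u ((e , v , inj₁ uv) ∷ us)
    vs  ← read adj v
    write adj v ((e , u , inj₂ uv) ∷ vs)

------------------------------------------------------------------------

module _ (F : OrderedField a ℓ₁ ℓ₂) where

  open OrderedField F

  -- Priority queues of items in Fin n, keyed in F, with the amortised
  -- bounds of Fibonacci heaps (Fredman and Tarjan), expressed by a
  -- potential Φ.  `keyOf q v` is the key of v in q, if v is in q.  Nothing
  -- is required of an operation whose precondition fails.  `empty` may
  -- take linear time, to allocate the table of handles of the n items.
  record FibonacciHeap (h : Level) : Set (a ⊔ ℓ₂ ⊔ suc h) where
    field
      Heap        : ℕ → Set h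
      keyOf       : Heap n → Fin n → Maybe Carrier
      empty       : Timed (Heap n)
      insert      : Fin n → Carrier → Heap n → Timed (Heap n)
      decreaseKey : Fin n → Carrier → Heap n → Timed (Heap n)
      extractMin  : Heap n → Timed (Maybe (Fin n × Heap n))

      empty-spec : (v : Fin n) → keyOf (value empty) v ≡ nothing

      insert-spec : ∀ (v : Fin n) x q → keyOf q v ≡ nothing →
        ∀ u → keyOf (value (insert v x q)) u ≡ (keyOf q [ v ]≔ just x) u

      decreaseKey-spec : ∀ (v : Fin n) x q {y} → keyOf q v ≡ just y → x < y →
        ∀ u → keyOf (value (decreaseKey v x q)) u ≡ (keyOf q [ v ]≔ just x) u

      extractMin-nothing : ∀ (q : Heap n) → value (extractMin q) ≡ nothing →
        ∀ u → keyOf q u ≡ nothing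

      extractMin-just : ∀ (q : Heap n) {v q′} → value (extractMin q) ≡ just (v , q′) →
        (∃ λ x → keyOf q v ≡ just x ×
                 (∀ u {y} → keyOf q u ≡ just y → ¬ (y < x))) ×
        (∀ u → keyOf q′ u ≡ (keyOf q [ v ]≔ nothing) u)

      Φ : Heap n → ℕ
      C : ℕ

      empty-cost : ∀ n → time (empty {n}) ℕ.+ Φ (value (empty {n})) ℕ.≤ C ℕ.* ℕ.suc n

      insert-cost : ∀ (v : Fin n) x q → keyOf q v ≡ nothing →
        time (insert v x q) ℕ.+ Φ (value (insert v x q)) ℕ.≤ Φ q ℕ.+ C

      decreaseKey-cost : ∀ (v : Fin n) x q {y} → keyOf q v ≡ just y → x < y →
        time (decreaseKey v x q) ℕ.+ Φ (value (decreaseKey v x q)) ℕ.≤ Φ q ℕ.+ C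

      extractMin-cost : ∀ (q : Heap n) →
        time (extractMin q) ℕ.+ Maybe.maybe′ (λ (_ , q′) → Φ q′) (Φ q) (value (extractMin q))
          ℕ.≤ Φ q ℕ.+ C ℕ.* ℕ.suc ⌊log₂ n ⌋

  weight : {G : Graph n m} → (Fin m → Carrier) → ∀ {u v} → Path G u v → Carrier
  weight w []            = 0#
  weight w (P ▷ (e , _)) = weight w P + w e

  Shortest : {G : Graph n m} → (Fin m → Carrier) → ∀ {u v} → Path G u v → Set (ℓ₁ ⊔ ℓ₂)
  Shortest {G = G} w {u} {v} P = (Q : Path G u v) → weight w P ≤ weight w Q

  ----------------------------------------------------------------------
  -- Dijkstra's algorithm from s.  A vertex enters the heap when it is
  -- first reached; it is labelled with the best distance and path so far.

  module Dijkstra (H : FibonacciHeap h) (G : Graph n m) (s : Fin n) where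

    open FibonacciHeap H

    Label : Fin n → Set a
    Label v = Maybe (Carrier × Path G s v)

    State : Set (a ⊔ h)
    State = Heap n × Array Label

    relax : (Fin m → Carrier) → ∀ {u} → Carrier → Path G s u →
            State → Incident G u → Timed State
    relax w d P (q , labels) (e , v , uv) = do
      wₑ ← read w e
      x  ← step (d + wₑ)
      just (y , _) ← read labels v
        where
        nothing → do
          Q      ← step (P ▷ (e , uv))
          labels ← write labels v (just (x , Q))
          q      ← insert v x q
          return (q , labels)
      shorter ← step (does (x <? y))
      if shorter
        then (do
          Q      ← step (P ▷ (e , uv))
          labels ← write labels v (just (x , Q))
          q      ← decreaseKey v x q
          return (q , labels))
        else return (q , labels)

    -- The main loop runs until the heap is empty.  The first argument
    -- bounds the number of iterations; n suffices, since each vertex is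
    -- extracted at most once.
    loop : ℕ → (Fin m → Carrier) → Array (λ u → List (Incident G u)) →
           State → Timed (Array Label)
    loop zero        w adj (q , labels) = return labels
    loop (ℕ.suc fuel) w adj (q , labels) = do
      just (u , q) ← extractMin q
        where nothing → step labels
      just (d , P) ← read labels u
        where nothing → return labels   -- impossible: u was labelled
      es    ← read adj u
      state ← for es from (q , labels) do′ relax w d P
      loop fuel w adj state

    dijkstra : (Fin m → Carrier) → Array (λ u → List (Incident G u)) →
               Timed (Array Label)
    dijkstra w adj = do
      labels ← new (λ _ → nothing)
      labels ← write labels s (just (0# , []))
      q      ← empty
      q      ← insert s 0# q
      loop n w adj (q , labels)

  ----------------------------------------------------------------------
  -- Instances of the constrained single-source shortest paths problem

  record Instance (n m : ℕ) : Set (a ⊔ ℓ₂) where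
    field
      G    : Graph n m
      w    : Fin m → Carrier
      0<w  : ∀ e → 0# < w e
      gray : Subset m
      s    : Fin n
      ε    : Carrier
      0<ε  : 0# < ε
      ε<1  : ε < 1#
      g    : ℕ
      0<g  : 0 ℕ.< g

    -- The largest edge weight; by convention 0# if there are no edges.
    W : Carrier
    W = Extrema.max totalOrder 0# (List.tabulate w)

    GShort : ∀ {t} → Path G s t → Set (ℓ₁ ⊔ ℓ₂)
    GShort {t} P =
      grayEdges gray P ℕ.< g ×
      ∃₂ λ s′ t′ →
      Σ (∃ λ e → Joins G e s s′) λ e₁ →
      Σ (Path G s′ t′) λ π →
      Σ (∃ λ e → Joins G e t′ t) λ e₂ →
      Shortest w π × P ≡ edge e₁ ∘ π ∘ edge e₂

  module _ (I : Instance n m) where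

    open Instance I

    -- `nothing` stands for the absence of an output path.
    SolvesWeakCSSSPWithError : ((t : Fin n) → Maybe (Path G s t)) → Set (ℓ₁ ⊔ ℓ₂)
    SolvesWeakCSSSPWithError output =
      ∀ t → ∃ (λ (Q : Path G s t) → GShort Q) →
      ∃ λ (P : Path G s t) →
        output t ≡ just P ×
        fromℕ (grayEdges gray P) ≤ fromℕ (5 ℕ.* g) * ε ⁻¹ ×
        (∀ (Pg : Path G s t) → grayEdges gray Pg ℕ.< g →
           weight w P < weight w Pg + ε * W)

    maxWeight : Timed Carrier
    maxWeight = for allFin m from 0# do′ λ x e → do
      y       ← read w e
      smaller ← step (does (x <? y))
      return (if smaller then y else x)

    perturbedWeights : Carrier → Timed (Fin m → Carrier)
    perturbedWeights δ = do
      w′ ← new (λ _ → 0#)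
      for allFin m from w′ do′ λ w′ e → do
        x  ← read w e
        c  ← step (Vec.lookup gray e)
        x′ ← (if c then step (x + δ) else return x)
        write w′ e x′

    procedure : FibonacciHeap h → Timed (Array λ t → Maybe (Path G s t))
    procedure H = do
      W̅      ← maxWeight
      εW     ← step (ε * W̅)
      g⁻¹    ← step (fromℕ g ⁻¹)
      δ      ← step (εW * g⁻¹)
      w′     ← perturbedWeights δ
      adj    ← buildAdjacency G
      labels ← Dijkstra.dijkstra H G s w′ adj
      new (λ t → Maybe.map proj₂ (labels t))

-- A w′-shortest path P satisfies w(P) + kδ ≤ w(Q) + qδ for every path Q with
-- the same ends, where k and q count gray edges and gδ = εW.  For q < g this
-- gives w(P) < w(Q) + εW at once.  If moreover Q = (s,s′) ∘ π ∘ (t′,t) is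
-- g-short, then w(π) ≤ w(P) + 2W, because (s′,s) ∘ P ∘ (t,t′) competes with
-- π; so w(Q) ≤ w(P) + 4W, hence kδ < 5W, that is k < 5g/ε.
--
-- Dijkstra's algorithm is analysed through an invariant of its main loop,
-- which shows both that labels are distances at termination and that every
-- heap operation meets its precondition.  The latter is needed for the time
-- bound, as the heap promises nothing otherwise.

module Submission where

open import Defs
open import Level using (Level; _⊔_)
open import Algebra.Bundles using (CommutativeRing)
open import Data.Bool.Base using (Bool; true; false; if_then_else_)
open import Data.Empty using (⊥; ⊥-elim)
open import Data.Fin.Base using (Fin; zero; suc)
open import Data.Fin.Properties using (_≟_)
open import Data.Fin.Subset using (Subset)
open import Data.List.Base using (List; []; _∷_; length; allFin; tabulate)
import Data.List.Extrema as Extrema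
open import Data.List.Membership.Propositional using (_∈_)
open import Data.List.Membership.Propositional.Properties using (∈-allFin)
open import Data.List.Properties using (length-tabulate)
open import Data.List.Relation.Unary.All.Properties using (tabulate⁻)
open import Data.List.Relation.Unary.Any using (Any; here; there)
open import Data.Maybe.Base as Maybe using (Maybe; just; nothing)
open import Data.Maybe.Properties using (just-injective)
open import Data.Nat.Base as ℕ using (ℕ; zero; suc; z≤n; s≤s)
open import Data.Nat.Logarithm using (⌊log₂_⌋; ⌊log₂⌋-mono-≤)
import Data.Nat.Properties as ℕₚ
open import Data.Nat.Solver using (module +-*-Solver)
open import Data.Product using (∃; ∃₂; _×_; _,_; proj₁; proj₂)
open import Data.Sum.Base as Sum using (_⊎_; inj₁; inj₂)
open import Data.Vec.Base using (lookup)
open import Data.Vec.Functional using (Vector)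
open import Relation.Binary.Bundles using (StrictTotalOrder; TotalOrder)
open import Relation.Binary.Definitions using (tri<; tri≈; tri>)
open import Relation.Binary.PropositionalEquality
  using (_≡_; _≢_; refl; sym; trans; cong; cong₂; subst; module ≡-Reasoning)
open import Relation.Nullary using (¬_; does; yes; no)
open import Algebra.Properties.CommutativeMonoid.Sum ℕₚ.+-0-commutativeMonoid
  using (sum; sum-cong-≗; sum-replicate-zero)
import Algebra.Properties.Semiring.Mult as Mult
import Algebra.Solver.Ring.NaturalCoefficients.Default as RingSolver
import Relation.Binary.Reasoning.StrictPartialOrder as StrictReasoning

private
  variable
    a p h ℓ₁ ℓ₂ : Level
    n m : ℕ

-- Amortised costs and rules for loops.

amortise : ∀ t₁ t₂ φ₀ {φ₁ φ₂ k₁ k₂} →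
  t₁ ℕ.+ φ₁ ℕ.≤ φ₀ ℕ.+ k₁ → t₂ ℕ.+ φ₂ ℕ.≤ φ₁ ℕ.+ k₂ →
  (t₁ ℕ.+ t₂) ℕ.+ φ₂ ℕ.≤ φ₀ ℕ.+ (k₁ ℕ.+ k₂)
amortise t₁ t₂ φ₀ {φ₁} {φ₂} {k₁} {k₂} h₁ h₂ = begin
  -- The second bound is applied first: it exposes the intermediate potential `φ₁`, which the first
  -- bound then consumes, so that potentials telescope.
  (t₁ ℕ.+ t₂) ℕ.+ φ₂   ≡⟨ ℕₚ.+-assoc t₁ t₂ φ₂ ⟩
  t₁ ℕ.+ (t₂ ℕ.+ φ₂)   ≤⟨ ℕₚ.+-monoʳ-≤ t₁ h₂ ⟩
  t₁ ℕ.+ (φ₁ ℕ.+ k₂)   ≡⟨ ℕₚ.+-assoc t₁ φ₁ k₂ ⟨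
  (t₁ ℕ.+ φ₁) ℕ.+ k₂   ≤⟨ ℕₚ.+-monoˡ-≤ k₂ h₁ ⟩
  (φ₀ ℕ.+ k₁) ℕ.+ k₂   ≡⟨ ℕₚ.+-assoc φ₀ k₁ k₂ ⟩
  φ₀ ℕ.+ (k₁ ℕ.+ k₂)   ∎
  where open ℕₚ.≤-Reasoning

amortise-steps : ∀ k t φ₀ {φ₁ l} →
  t ℕ.+ φ₁ ℕ.≤ φ₀ ℕ.+ l → (k ℕ.+ t) ℕ.+ φ₁ ℕ.≤ φ₀ ℕ.+ (k ℕ.+ l)
amortise-steps k t φ₀ {φ₁} {l} h =
  amortise k t φ₀ {φ₀} (ℕₚ.≤-reflexive (ℕₚ.+-comm k φ₀)) h

-- A Hoare rule with potential `Ψ`. The invariant is indexed by the elements still to come, so that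
-- it can say which work is outstanding; the `suc` pays for the step charged to each iteration.
for-rule : {A : Set a} {B : Set p} (Inv : List A → B → Set ℓ₁) (Ψ : B → ℕ) (k : ℕ)
  (body : B → A → Timed B) →
  (∀ x xs acc → Inv (x ∷ xs) acc →
     Inv xs (value (body acc x)) ×
     time (body acc x) ℕ.+ Ψ (value (body acc x)) ℕ.≤ Ψ acc ℕ.+ k) →
  ∀ xs acc → Inv xs acc →
  let r = for xs from acc do′ body in
  Inv [] (value r) × time r ℕ.+ Ψ (value r) ℕ.≤ Ψ acc ℕ.+ length xs ℕ.* suc k
for-rule Inv Ψ k body pres [] acc inv = inv , ℕₚ.≤-reflexive (sym (ℕₚ.+-identityʳ _))
for-rule Inv Ψ k body pres (x ∷ xs) acc inv
  with pres x xs acc inv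
... | inv₁ , t₁ with for-rule Inv Ψ k body pres xs _ inv₁
... | inv₂ , t₂ = inv₂ , amortise (suc (time (body acc x))) (time (for xs from _ do′ body)) (Ψ acc)
  (amortise-steps 1 (time (body acc x)) (Ψ acc) t₁) t₂

-- The case of zero potential, for bodies with a worst-case bound.
for-rule₀ : {A : Set a} {B : Set p} (Inv : List A → B → Set ℓ₁) (k : ℕ)
  (body : B → A → Timed B) →
  (∀ x xs acc → Inv (x ∷ xs) acc →
     Inv xs (value (body acc x)) × time (body acc x) ℕ.≤ k) →
  ∀ xs acc → Inv xs acc →
  let r = for xs from acc do′ body in
  Inv [] (value r) × time r ℕ.≤ length xs ℕ.* suc k
for-rule₀ Inv k body pres xs acc inv
  with for-rule Inv (λ _ → 0) k body
         (λ x xs acc i → let (i′ , t) = pres x xs acc i in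
            i′ , subst (ℕ._≤ k) (sym (ℕₚ.+-identityʳ _)) t) xs acc inv
... | inv′ , t = inv′ , subst (ℕ._≤ _) (ℕₚ.+-identityʳ _) t

-- Array updates, and sums over the vertices.

update-elim : {B : Fin n → Set a} (arr : Array B) (i : Fin n) (x : B i)
  (P : ∀ j → B j → Set p) → P i x → (∀ j → i ≢ j → P j (arr j)) →
  ∀ j → P j ((arr [ i ]≔ x) j)
update-elim arr i x P new old j with i ≟ j
... | yes refl = new
... | no i≢j   = old j i≢j

update-same : {B : Fin n → Set a} (arr : Array B) (i : Fin n) (x : B i) →
  (arr [ i ]≔ x) i ≡ x
update-same arr i x with i ≟ i
... | yes refl = refl
... | no i≢i   = ⊥-elim (i≢i refl)

update-other : {B : Fin n → Set a} (arr : Array B) {i : Fin n} (x : B i) {j : Fin n} →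
  i ≢ j → (arr [ i ]≔ x) j ≡ arr j
update-other arr {i} x {j} i≢j with i ≟ j
... | yes i≡j = ⊥-elim (i≢j i≡j)
... | no _    = refl

term≤sum : (f : Vector ℕ n) (i : Fin n) → f i ℕ.≤ sum f
term≤sum f zero    = ℕₚ.m≤m+n _ _
term≤sum f (suc i) = ℕₚ.≤-trans (term≤sum (λ j → f (suc j)) i) (ℕₚ.m≤n+m _ _)

-- Stated with both sides moved, so that no subtraction occurs.
sum-change : (f g : Vector ℕ n) (i : Fin n) → (∀ j → i ≢ j → f j ≡ g j) →
  sum f ℕ.+ g i ≡ sum g ℕ.+ f i
sum-change f g zero f≗g = begin
  (f zero ℕ.+ sum f′) ℕ.+ g zero   ≡⟨ cong (λ x → (f zero ℕ.+ x) ℕ.+ g zero)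
                                        (sum-cong-≗ {x = f′} {y = g′} (λ j → f≗g (suc j) λ ())) ⟩
  (f zero ℕ.+ sum g′) ℕ.+ g zero   ≡⟨ solve 3 (λ x y z → (x :+ y) :+ z := (z :+ y) :+ x) refl
                                        (f zero) (sum g′) (g zero) ⟩
  (g zero ℕ.+ sum g′) ℕ.+ f zero   ∎
  where
  open ≡-Reasoning
  open +-*-Solver
  f′ = λ j → f (suc j)
  g′ = λ j → g (suc j)
sum-change f g (suc i) f≗g = begin
  (f zero ℕ.+ sum f′) ℕ.+ g (suc i)  ≡⟨ ℕₚ.+-assoc (f zero) _ _ ⟩
  f zero ℕ.+ (sum f′ ℕ.+ g (suc i))  ≡⟨ cong₂ ℕ._+_ (f≗g zero λ ())
                                         (sum-change f′ g′ i λ j i≢j → f≗g (suc j) λ { refl → i≢j refl }) ⟩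
  g zero ℕ.+ (sum g′ ℕ.+ f (suc i))  ≡⟨ ℕₚ.+-assoc (g zero) _ _ ⟨
  (g zero ℕ.+ sum g′) ℕ.+ f (suc i)  ∎
  where
  open ≡-Reasoning
  f′ = λ j → f (suc j)
  g′ = λ j → g (suc j)

-- Used twice: with `f` constantly 1 it is the fuel of the main loop, with `f` the degree it is the
-- number of relaxations still to be paid for.
remaining : (Fin n → Bool) → Vector ℕ n → ℕ
remaining settled f = sum λ v → if settled v then 0 else f v

remaining-settle : (settled : Fin n → Bool) (f : Vector ℕ n) {u : Fin n} → settled u ≡ false →
  remaining settled f ≡ f u ℕ.+ remaining (settled [ u ]≔ true) f
remaining-settle {n} settled f {u} u-open = begin
  sum before                ≡⟨ ℕₚ.+-identityʳ _ ⟨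
  -- The 0 is `after u`, as `u` is settled in the updated array; this brings the sum into the form
  -- of `sum-change`.
  sum before ℕ.+ 0          ≡⟨ cong (λ b → sum before ℕ.+ (if b then 0 else f u))
                                 (update-same settled u true) ⟨
  sum before ℕ.+ after u    ≡⟨ sum-change before after u (λ j u≢j →
                                 cong (if_then 0 else f j) (sym (update-other settled true u≢j))) ⟩
  sum after ℕ.+ before u    ≡⟨ ℕₚ.+-comm (sum after) _ ⟩
  before u ℕ.+ sum after    ≡⟨ cong (λ b → (if b then 0 else f u) ℕ.+ sum after) u-open ⟩
  f u ℕ.+ sum after         ∎
  where
  open ≡-Reasoning
  before after : Vector ℕ n
  before v = if settled v then 0 else f v
  after v  = if (settled [ u ]≔ true) v then 0 else f v

-- An open vertex would contribute a summand 1, and no summand exceeds the sum.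
remaining≡0 : (settled : Fin n → Bool) → remaining settled (λ _ → 1) ≡ 0 → ∀ v → settled v ≡ true
remaining≡0 settled none v with settled v | term≤sum (λ v → if settled v then 0 else 1) v
... | true  | _   = refl
... | false | 1≤0 with subst (1 ℕ.≤_) none 1≤0
... | ()

-- Arithmetic in an ordered field.

module OrderedFieldProperties (F : OrderedField a ℓ₁ ℓ₂) where

  open OrderedField F
  open CommutativeRing commutativeRing public
    using (+-cong; +-congˡ; +-congʳ; *-congˡ; *-congʳ; +-comm; +-assoc; *-comm;
           +-identityˡ; +-identityʳ; *-identityˡ; zeroˡ; distribʳ; -‿inverseˡ; -‿inverseʳ; semiring)
    renaming (refl to ≈-refl; sym to ≈-sym; trans to ≈-trans; reflexive to ≈-reflexive)
  open StrictTotalOrder strictTotalOrder public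
    using (compare; irrefl; asym; <-respʳ-≈; <-respˡ-≈)
  open TotalOrder totalOrder public
    using () renaming (refl to ≤-refl; trans to ≤-trans; reflexive to ≤-reflexive)
  open Mult semiring using (×-homo-+; ×1-homo-*)
  module Solver = RingSolver (CommutativeRing.commutativeSemiring commutativeRing)
  module Reasoning = StrictReasoning (StrictTotalOrder.strictPartialOrder strictTotalOrder)
  open Reasoning

  ≮⇒≥ : ∀ {x y} → ¬ (x < y) → y ≤ x
  ≮⇒≥ {x} {y} x≮y with compare x y
  ... | tri< x<y _ _ = ⊥-elim (x≮y x<y)
  ... | tri≈ _ x≈y _ = inj₂ (≈-sym x≈y)
  ... | tri> _ _ y<x = inj₁ y<x

  <⇒≱ : ∀ {x y} → x < y → ¬ (y ≤ x)
  <⇒≱ x<y (inj₁ y<x) = asym x<y y<x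
  <⇒≱ x<y (inj₂ y≈x) = irrefl (≈-sym y≈x) x<y

  +-monoʳ-≤ : ∀ x {y z} → y ≤ z → x + y ≤ x + z
  +-monoʳ-≤ x (inj₁ y<z) = inj₁ (+-monoʳ-< x y<z)
  +-monoʳ-≤ x (inj₂ y≈z) = inj₂ (+-congˡ y≈z)

  +-monoˡ-< : ∀ x {y z} → y < z → y + x < z + x
  +-monoˡ-< x {y} {z} y<z = begin-strict
    y + x  ≈⟨ +-comm y x ⟩
    x + y  <⟨ +-monoʳ-< x y<z ⟩
    x + z  ≈⟨ +-comm x z ⟩
    z + x  ∎

  +-monoˡ-≤ : ∀ x {y z} → y ≤ z → y + x ≤ z + x
  +-monoˡ-≤ x (inj₁ y<z) = inj₁ (+-monoˡ-< x y<z)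
  +-monoˡ-≤ x (inj₂ y≈z) = inj₂ (+-congʳ y≈z)

  +-mono-≤ : ∀ {x y u v} → x ≤ y → u ≤ v → x + u ≤ y + v
  +-mono-≤ {y = y} {u = u} x≤y u≤v = ≤-trans (+-monoˡ-≤ u x≤y) (+-monoʳ-≤ y u≤v)

  +-cancelˡ-≤ : ∀ x {y z} → x + y ≤ x + z → y ≤ z
  +-cancelˡ-≤ x x+y≤x+z = ≮⇒≥ λ z<y → <⇒≱ (+-monoʳ-< x z<y) x+y≤x+z

  x≤x+y : ∀ x {y} → 0# ≤ y → x ≤ x + y
  x≤x+y x {y} 0≤y = begin
    x       ≈⟨ +-identityʳ x ⟨
    x + 0#  ≤⟨ +-monoʳ-≤ x 0≤y ⟩
    x + y   ∎

  -- The axioms speak only of products of positive elements, so the product taken is `(y - x) * z`,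
  -- to which `x * z` is added back.
  *-monoˡ-< : ∀ {x y z} → 0# < z → x < y → x * z < y * z
  *-monoˡ-< {x} {y} {z} 0<z x<y = begin-strict
    x * z                      ≈⟨ +-identityˡ _ ⟨
    0# + x * z                 <⟨ +-monoˡ-< (x * z) (*-pos 0<y-x 0<z) ⟩
    (y + - x) * z + x * z      ≈⟨ distribʳ z (y + - x) x ⟨
    ((y + - x) + x) * z        ≈⟨ *-congʳ (+-assoc y (- x) x) ⟩
    (y + (- x + x)) * z        ≈⟨ *-congʳ (+-congˡ (-‿inverseˡ x)) ⟩
    (y + 0#) * z               ≈⟨ *-congʳ (+-identityʳ y) ⟩
    y * z                      ∎
    where
    0<y-x : 0# < y + - x
    0<y-x = <-respˡ-≈ (-‿inverseʳ x) (+-monoˡ-< (- x) x<y)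

  *-monoˡ-≤ : ∀ {x y z} → 0# < z → x ≤ y → x * z ≤ y * z
  *-monoˡ-≤ 0<z (inj₁ x<y) = inj₁ (*-monoˡ-< 0<z x<y)
  *-monoˡ-≤ 0<z (inj₂ x≈y) = inj₂ (*-congʳ x≈y)

  >⇒≉ : ∀ {x y} → y < x → ¬ (x ≈ y)
  >⇒≉ y<x x≈y = irrefl (≈-sym x≈y) y<x

  -- Were `x ⁻¹` zero or negative, then so would be `x * x ⁻¹`, which is 1.
  ⁻¹-pos : ∀ {x} → 0# < x → 0# < x ⁻¹
  ⁻¹-pos {x} 0<x with compare 0# (x ⁻¹)
  ... | tri< 0<x⁻¹ _ _ = 0<x⁻¹
  ... | tri≈ _ 0≈x⁻¹ _ = ⊥-elim (irrefl
        (≈-trans (≈-sym (zeroˡ x)) (≈-trans (*-congʳ 0≈x⁻¹)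
          (≈-trans (*-comm _ x) (⁻¹-inverseʳ (>⇒≉ 0<x))))) 0<1)
  ... | tri> _ _ x⁻¹<0 = ⊥-elim (asym 0<1
        (<-respˡ-≈ (≈-trans (*-comm _ x) (⁻¹-inverseʳ (>⇒≉ 0<x)))
          (<-respʳ-≈ (zeroˡ x) (*-monoˡ-< 0<x x⁻¹<0))))

  fromℕ-nonneg : ∀ k → 0# ≤ fromℕ k
  fromℕ-nonneg zero    = ≤-refl
  fromℕ-nonneg (suc k) = ≤-trans (inj₁ 0<1) (x≤x+y 1# (fromℕ-nonneg k))

  fromℕ-mono-< : ∀ {k l} → k ℕ.< l → fromℕ k < fromℕ l
  fromℕ-mono-< {zero}  {suc l} _         = begin-strict
    0#            <⟨ 0<1 ⟩
    1#            ≤⟨ x≤x+y 1# (fromℕ-nonneg l) ⟩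
    1# + fromℕ l  ∎
  fromℕ-mono-< {suc k} {suc l} (s≤s k<l) = +-monoʳ-< 1# (fromℕ-mono-< k<l)

  fromℕ-+ : ∀ k l → fromℕ (k ℕ.+ l) ≈ fromℕ k + fromℕ l
  fromℕ-+ = ×-homo-+ 1#

  module _ {ε W̅ : Carrier} {g : ℕ} (0<ε : 0# < ε) (0<W̅ : 0# < W̅) (0<g : 0 ℕ.< g) where

    -- The surcharge on a gray edge, scaled so that `g` surcharges make up `ε * W̅`.
    δ : Carrier
    δ = (ε * W̅) * fromℕ g ⁻¹

    gδ≈εW̅ : fromℕ g * δ ≈ ε * W̅
    gδ≈εW̅ = begin-equality
      fromℕ g * ((ε * W̅) * fromℕ g ⁻¹)    ≈⟨ solve 3 (λ x y z → x :* (y :* z) := (x :* z) :* y) ≈-refl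
                                              (fromℕ g) (ε * W̅) (fromℕ g ⁻¹) ⟩
      (fromℕ g * fromℕ g ⁻¹) * (ε * W̅)    ≈⟨ *-congʳ (⁻¹-inverseʳ (>⇒≉ (fromℕ-mono-< 0<g))) ⟩
      1# * (ε * W̅)                        ≈⟨ *-identityˡ _ ⟩
      ε * W̅                               ∎
      where open Solver

    0<δ : 0# < δ
    0<δ = *-pos (*-pos 0<ε 0<W̅) (⁻¹-pos (fromℕ-mono-< 0<g))

    -- The strictness of the final error bound comes from here.
    kδ<εW̅ : ∀ {k} → k ℕ.< g → fromℕ k * δ < ε * W̅
    kδ<εW̅ k<g = <-respʳ-≈ gδ≈εW̅ (*-monoˡ-< 0<δ (fromℕ-mono-< k<g))

    -- Multiplying `5g/ε < k` by `δ` would give `kδ > (5/ε)(gδ) = (5/ε)(εW̅) = 5W̅`.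
    kδ≤5W̅⇒k≤5g/ε : ∀ k → fromℕ k * δ ≤ fromℕ 5 * W̅ → fromℕ k ≤ fromℕ (5 ℕ.* g) * ε ⁻¹
    kδ≤5W̅⇒k≤5g/ε k kδ≤5W̅ = ≮⇒≥ λ 5g/ε<k → <⇒≱ (*-monoˡ-< 0<δ 5g/ε<k) (begin
      fromℕ k * δ                            ≤⟨ kδ≤5W̅ ⟩
      fromℕ 5 * W̅                            ≈⟨ *-congˡ (*-identityˡ W̅) ⟨
      fromℕ 5 * (1# * W̅)                     ≈⟨ *-congˡ (*-congʳ (⁻¹-inverseʳ (>⇒≉ 0<ε))) ⟨
      fromℕ 5 * ((ε * ε ⁻¹) * W̅)             ≈⟨ solve 4 (λ x y z v →
                                                    x :* ((y :* z) :* v) := (x :* z) :* (y :* v))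
                                                  ≈-refl (fromℕ 5) ε (ε ⁻¹) W̅ ⟩
      (fromℕ 5 * ε ⁻¹) * (ε * W̅)             ≈⟨ *-congˡ gδ≈εW̅ ⟨
      (fromℕ 5 * ε ⁻¹) * (fromℕ g * δ)       ≈⟨ solve 4 (λ x y z v →
                                                    (x :* y) :* (z :* v) := ((x :* z) :* y) :* v)
                                                  ≈-refl (fromℕ 5) (ε ⁻¹) (fromℕ g) δ ⟩
      ((fromℕ 5 * fromℕ g) * ε ⁻¹) * δ       ≈⟨ *-congʳ (*-congʳ (×1-homo-* 5 g)) ⟨
      (fromℕ (5 ℕ.* g) * ε ⁻¹) * δ           ∎)
      where open Solver

-- Loops over all edges.

length-allFin : ∀ n → length (allFin n) ≡ n
length-allFin n = length-tabulate {n = n} (λ i → i)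

-- The loop invariant is that each index is either still on the list or already has its property;
-- visiting `e` establishes the property at `e` and destroys it nowhere.
for-allFin : {B : Set p} (P : Fin m → B → Set ℓ₁) (k : ℕ) (body : B → Fin m → Timed B) →
  (∀ e acc → P e (value (body acc e)) × (∀ i → P i acc → P i (value (body acc e))) ×
             time (body acc e) ℕ.≤ k) →
  ∀ acc → let r = for allFin m from acc do′ body in
  (∀ e → P e (value r)) × time r ℕ.≤ m ℕ.* suc k
for-allFin {m = m} P k body sound acc =
  all , ℕₚ.≤-trans t (ℕₚ.≤-reflexive (cong (ℕ._* suc k) (length-allFin m)))
  where
  done : _
  done = for-rule₀ (λ es x → ∀ e → e ∈ es ⊎ P e x) k body
    (λ e es x inv → let (new , old , t) = sound e x in
      (λ i → case i e es new (old i) (inv i)) , t)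
    (allFin m) acc (λ e → inj₁ (∈-allFin e))
    where
    case : ∀ i e es {x y} → P e y → (P i x → P i y) → i ∈ e ∷ es ⊎ P i x → i ∈ es ⊎ P i y
    case i e es new old (inj₁ (here refl)) = inj₂ new
    case i e es new old (inj₁ (there i∈))  = inj₁ i∈
    case i e es new old (inj₂ Pi)          = inj₂ (old Pi)
  all : ∀ e → _
  all e with proj₁ done e
  ... | inj₂ Pe = Pe
  t = proj₂ done

-- Adjacency lists.

module Adjacency {n m : ℕ} (G : Graph n m) where

  Adj : Set
  Adj = Array λ u → List (Incident G u)

  -- The proof of incidence is not compared, since a loop has two of them.
  Is : Fin m → Fin n → ∀ {u} → Incident G u → Set
  Is e v (e′ , v′ , _) = e ≡ e′ × v ≡ v′

  push : Adj → ∀ u → Incident G u → Adj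
  push adj u i = adj [ u ]≔ (i ∷ adj u)

  push-new : ∀ adj u i → Any (Is (proj₁ i) (proj₁ (proj₂ i))) (push adj u i u)
  push-new adj u i = subst (Any _) (sym (update-same adj u (i ∷ adj u))) (here (refl , refl))

  push-old : ∀ adj u i {e v} x → Any (Is e v) (adj x) → Any (Is e v) (push adj u i x)
  push-old adj u i {e} {v} =
    update-elim adj u (i ∷ adj u) (λ x is → Any (Is e v) (adj x) → Any (Is e v) is) there (λ _ _ p → p)

  degreeSum : Adj → ℕ
  degreeSum adj = sum λ u → length (adj u)

  -- Only the summand at `u` changes; `sum-change` puts its old length on both sides, where it
  -- cancels.
  degreeSum-push : ∀ adj u i → degreeSum (push adj u i) ≡ suc (degreeSum adj)
  degreeSum-push adj u i = ℕₚ.+-cancelʳ-≡ (length (adj u)) _ _ (begin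
    degreeSum (push adj u i) ℕ.+ length (adj u)
      ≡⟨ sum-change (λ x → length (push adj u i x)) (λ x → length (adj x)) u
           (λ j u≢j → cong length (update-other adj {u} (i ∷ adj u) u≢j)) ⟩
    degreeSum adj ℕ.+ length (push adj u i u)     ≡⟨ cong (λ is → degreeSum adj ℕ.+ length is)
                                                       (update-same adj u (i ∷ adj u)) ⟩
    degreeSum adj ℕ.+ suc (length (adj u))        ≡⟨ ℕₚ.+-suc _ _ ⟩
    suc (degreeSum adj) ℕ.+ length (adj u)        ∎)
    where open ≡-Reasoning

  -- Soundness is part of the type, as each entry carries a proof of `Joins`; this is the converse.
  Complete : Adj → Set
  Complete adj = ∀ {e u v} → Joins G e u v → Any (Is e v) (adj u)

  private
    -- The second component is the handshake identity: an edge not yet processed stands for its two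
    -- future entries, both in the same list if it is a loop.
    Inv : List (Fin m) → Adj → Set
    Inv es adj = (∀ {e u v} → Joins G e u v → e ∈ es ⊎ Any (Is e v) (adj u)) ×
                 degreeSum adj ℕ.+ 2 ℕ.* length es ≡ 2 ℕ.* m

    end₁ end₂ : Fin m → Fin n
    end₁ e = proj₁ (G e)
    end₂ e = proj₂ (G e)

    outgoing : ∀ e → Incident G (end₁ e)
    outgoing e = e , end₂ e , inj₁ refl

    incoming : ∀ e → Incident G (end₂ e)
    incoming e = e , end₁ e , inj₂ refl

    add₁ add : Adj → Fin m → Adj
    add₁ adj e = push adj (end₁ e) (outgoing e)
    add adj e = push (add₁ adj e) (end₂ e) (incoming e)

    add-old : ∀ adj e {e′ v} u → Any (Is e′ v) (adj u) → Any (Is e′ v) (add adj e u)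
    add-old adj e u i∈ =
      push-old (add₁ adj e) (end₂ e) (incoming e) u (push-old adj (end₁ e) (outgoing e) u i∈)

    add-new : ∀ adj {e u v} → Joins G e u v → Any (Is e v) (add adj e u)
    add-new adj {e} (inj₁ refl) =
      push-old (add₁ adj e) (end₂ e) (incoming e) (end₁ e) (push-new adj (end₁ e) (outgoing e))
    add-new adj {e} (inj₂ refl) = push-new (add₁ adj e) (end₂ e) (incoming e)

    add-sound : ∀ e es adj → Inv (e ∷ es) adj → Inv es (add adj e)
    add-sound e es adj (listed , degrees) = listed′ , (begin
      degreeSum (add adj e) ℕ.+ 2 ℕ.* length es   ≡⟨ cong (ℕ._+ 2 ℕ.* length es)
        (trans (degreeSum-push (add₁ adj e) (end₂ e) (incoming e))
               (cong suc (degreeSum-push adj (end₁ e) (outgoing e)))) ⟩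
      2 ℕ.+ degreeSum adj ℕ.+ 2 ℕ.* length es     ≡⟨ solve 2 (λ x y → con 2 :+ x :+ con 2 :* y :=
                                                       x :+ con 2 :* (con 1 :+ y)) refl
                                                       (degreeSum adj) (length es) ⟩
      degreeSum adj ℕ.+ 2 ℕ.* suc (length es)     ≡⟨ degrees ⟩
      2 ℕ.* m                                     ∎)
      where
      open ≡-Reasoning
      open +-*-Solver
      listed′ : ∀ {e′ u v} → Joins G e′ u v → e′ ∈ es ⊎ Any (Is e′ v) (add adj e u)
      listed′ joins with listed joins
      ... | inj₁ (here refl) = inj₂ (add-new adj joins)
      ... | inj₁ (there e∈)  = inj₁ e∈
      ... | inj₂ old         = inj₂ (add-old adj e _ old)

  -- The body takes five steps and the iteration itself a sixth; `n` is for the allocation.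
  buildAdjacency-spec : let r = buildAdjacency G in
    Complete (value r) × degreeSum (value r) ≡ 2 ℕ.* m × time r ℕ.≤ n ℕ.+ m ℕ.* 6
  buildAdjacency-spec with for-rule₀ Inv 5 _ (λ e es adj inv → add-sound e es adj inv , ℕₚ.≤-refl)
      (allFin m) (λ _ → []) ((λ {e} _ → inj₁ (∈-allFin e)) ,
        cong₂ ℕ._+_ (sum-replicate-zero n) (cong (2 ℕ.*_) (length-allFin m)))
  ... | (listed , degrees) , t = complete , trans (sym (ℕₚ.+-identityʳ _)) degrees ,
      ℕₚ.+-monoʳ-≤ n (ℕₚ.≤-trans t (ℕₚ.≤-reflexive (cong (ℕ._* 6) (length-allFin m))))
    where
    complete : Complete _
    complete joins with listed joins
    ... | inj₂ p = p

-- Maximum weight and perturbed weights.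

module Preprocessing (F : OrderedField a ℓ₁ ℓ₂) (I : Instance F n m) where

  open OrderedField F
  open OrderedFieldProperties F
  open Instance I

  W-upper : ∀ e → w e ≤ W
  W-upper = tabulate⁻ (Extrema.xs≤max totalOrder 0# (tabulate w))

  -- Two inequalities serve in place of equality with `W`: the lower bound on the result drives the
  -- count of gray edges, the upper bound the error term. Each has its own loop invariant.
  maxWeight-spec : let r = maxWeight F I in
    (∀ e → w e ≤ value r) × value r ≤ W × time r ℕ.≤ m ℕ.* 3
  maxWeight-spec = let (upper , t) = for-allFin (λ e x → w e ≤ x) 2 _ increase 0# in
    upper , proj₁ (for-rule₀ (λ _ x → x ≤ W) 2 _ bounded (allFin m) 0#
      (Extrema.⊥≤max totalOrder 0# (tabulate w))) , t
    where
    larger : Carrier → Fin m → Carrier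
    larger x e = if does (x <? w e) then w e else x
    increase : ∀ e x → w e ≤ larger x e × (∀ i → w i ≤ x → w i ≤ larger x e) × 2 ℕ.≤ 2
    increase e x with x <? w e
    ... | yes x<w = ≤-refl , (λ _ w≤x → ≤-trans w≤x (inj₁ x<w)) , ℕₚ.≤-refl
    ... | no  x≮w = ≮⇒≥ x≮w , (λ _ w≤x → w≤x) , ℕₚ.≤-refl
    bounded : ∀ e es x → x ≤ W → larger x e ≤ W × 2 ℕ.≤ 2
    bounded e es x x≤W with x <? w e
    ... | yes _ = W-upper e , ℕₚ.≤-refl
    ... | no  _ = x≤W , ℕₚ.≤-refl

  perturb : Carrier → Fin m → Carrier
  perturb δ e = if lookup gray e then w e + δ else w e

  perturbedWeights-spec : ∀ δ → let r = perturbedWeights F I δ in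
    (∀ e → value r e ≡ perturb δ e) × time r ℕ.≤ m ℕ.+ m ℕ.* 5
  perturbedWeights-spec δ =
    let (exact , t) = for-allFin (λ e w′ → w′ e ≡ perturb δ e) 4 _ assign (λ _ → 0#) in
    exact , ℕₚ.+-monoʳ-≤ m t
    where
    perturbed : Bool → Fin m → Timed Carrier
    perturbed c e = if c then step (w e + δ) else return (w e)
    -- The steps are a read, a lookup and a write, and one addition if the edge is gray.
    perturbed-spec : ∀ c e → value (perturbed c e) ≡ (if c then w e + δ else w e) ×
                             2 ℕ.+ (time (perturbed c e) ℕ.+ 1) ℕ.≤ 4
    perturbed-spec true  e = refl , ℕₚ.≤-refl
    perturbed-spec false e = refl , s≤s (s≤s (s≤s z≤n))
    assign : ∀ e (w′ : Fin m → Carrier) → let c = perturbed (lookup gray e) e in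
      (w′ [ e ]≔ value c) e ≡ perturb δ e ×
      (∀ i → w′ i ≡ perturb δ i → (w′ [ e ]≔ value c) i ≡ perturb δ i) ×
      2 ℕ.+ (time c ℕ.+ 1) ℕ.≤ 4
    assign e w′ = let (eq , t) = perturbed-spec (lookup gray e) e in
      trans (update-same w′ e _) eq ,
      update-elim w′ e _ (λ i y → w′ i ≡ perturb δ i → y ≡ perturb δ i) (λ _ → eq) (λ _ _ p → p) , t

-- Dijkstra's algorithm: invariant, correctness and running time.

sum-ones : ∀ n → sum {n} (λ _ → 1) ≡ n
sum-ones zero    = refl
sum-ones (suc n) = cong suc (sum-ones n)

module DijkstraCorrectness (F : OrderedField a ℓ₁ ℓ₂) (H : FibonacciHeap F h)
  (G : Graph n m) (s : Fin n) (w : Fin m → OrderedField.Carrier F)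
  (0≤w : ∀ e → OrderedField._≤_ F (OrderedField.0# F) (w e)) where

  open OrderedField F
  open OrderedFieldProperties F
  open FibonacciHeap H
  open Dijkstra F H G s
  open Adjacency G

  -- An upper bound on the label rather than its value: labels only decrease, so such facts survive
  -- every update.
  Reached : Array Label → Fin n → Carrier → Set _
  Reached labels v x = ∃₂ λ y Q → labels v ≡ just (y , Q) × y ≤ x

  -- The vertices extracted so far are `settled`; `b` is the largest key
  -- extracted.  `Pending u e v` allows the edge e from the settled u to v
  -- not to have been relaxed yet.
  record Invariant (settled : Fin n → Bool) (b : Carrier)
                   (Pending : Fin n → Fin m → Fin n → Set)
                   (q : Heap n) (labels : Array Label) : Set (a ⊔ ℓ₁ ⊔ ℓ₂) where
    field
      settled-key   : ∀ v → settled v ≡ true → keyOf q v ≡ nothing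
      settled-label : ∀ v → settled v ≡ true → Reached labels v b
      open-key      : ∀ v → settled v ≡ false → keyOf q v ≡ Maybe.map proj₁ (labels v)
      open-label    : ∀ v → settled v ≡ false → ∀ {y Q} → labels v ≡ just (y , Q) → b ≤ y
      label-weight  : ∀ v {y Q} → labels v ≡ just (y , Q) → y ≡ weight F w Q
      relaxed       : ∀ u → settled u ≡ true → ∀ {y Q} → labels u ≡ just (y , Q) →
                      ∀ {e v} → Joins G e u v → Pending u e v ⊎ Reached labels v (y + w e)
      source        : Reached labels s 0#

  open Invariant

  private
    variable
      settled : Fin n → Bool
      b : Carrier
      Pending Pending′ : Fin n → Fin m → Fin n → Set
      q q′ : Heap n
      labels : Array Label

  -- `Pending` occurs only in `relaxed`, so the other fields carry over when the set of outstanding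
  -- edges changes.
  discharge : Invariant settled b Pending q labels →
    (∀ u {y Q} → labels u ≡ just (y , Q) → ∀ {e v} → Joins G e u v → Pending u e v →
       Pending′ u e v ⊎ Reached labels v (y + w e)) →
    Invariant settled b Pending′ q labels
  discharge inv f = record
    { settled-key   = inv .settled-key
    ; settled-label = inv .settled-label
    ; open-key      = inv .open-key
    ; open-label    = inv .open-label
    ; label-weight  = inv .label-weight
    ; relaxed       = λ u u-settled lu joins →
        Sum.[ f u lu joins , inj₂ ]′ (inv .relaxed u u-settled lu joins)
    ; source        = inv .source
    }

  -- Covers insertion and key decrease alike, as both give the open `v` the key and label `x`.
  -- Settled vertices are untouched, and `b ≤ x` keeps open labels above the last extracted key.
  improve : ∀ {v x Q} → Invariant settled b Pending q labels →
    settled v ≡ false → b ≤ x → x ≡ weight F w Q →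
    (∀ {y Q′} → labels v ≡ just (y , Q′) → x ≤ y) →
    (∀ u → keyOf q′ u ≡ (keyOf q [ v ]≔ just x) u) →
    Invariant settled b Pending q′ (labels [ v ]≔ just (x , Q))
  improve {settled} {b} {Pending} {q} {labels} {q′} {v} {x} {Q} inv v-open b≤x x≡wQ x≤ keys = record
    { settled-key   = λ u u-settled → trans (keys u)
        (trans (update-other (keyOf q) {v} (just x) (v≢ u-settled)) (inv .settled-key u u-settled))
    ; settled-label = λ u u-settled → reached (inv .settled-label u u-settled)
    ; open-key      = λ u u-open → trans (keys u) (key u u-open)
    ; open-label    = update-elim labels v (just (x , Q))
        (λ u l → settled u ≡ false → ∀ {y Q} → l ≡ just (y , Q) → b ≤ y)
        (λ { _ refl → b≤x }) (λ u _ → inv .open-label u)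
    ; label-weight  = update-elim labels v (just (x , Q))
        (λ u l → ∀ {y Q} → l ≡ just (y , Q) → y ≡ weight F w Q)
        (λ { refl → x≡wQ }) (λ u _ → inv .label-weight u)
    ; relaxed       = λ u u-settled lu joins → Sum.map₂ reached
        (inv .relaxed u u-settled
          (trans (sym (update-other labels {v} (just (x , Q)) (v≢ u-settled))) lu) joins)
    ; source        = reached (inv .source)
    }
    where
    v≢ : ∀ {u} → settled u ≡ true → v ≢ u
    v≢ u-settled refl with trans (sym u-settled) v-open
    ... | ()
    key : ∀ u → settled u ≡ false →
      (keyOf q [ v ]≔ just x) u ≡ Maybe.map proj₁ ((labels [ v ]≔ just (x , Q)) u)
    key u u-open with v ≟ u
    ... | yes refl = refl
    ... | no _     = inv .open-key u u-open
    reached : ∀ {u z} → Reached labels u z → Reached (labels [ v ]≔ just (x , Q)) u z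
    reached {u} {z} = update-elim labels v (just (x , Q))
      (λ u l → Reached labels u z → ∃₂ λ y Q → l ≡ just (y , Q) × y ≤ z)
      (λ (y , Q′ , lv , y≤z) → x , Q , refl , ≤-trans (x≤ lv) y≤z) (λ _ _ r → r) u

  -- The greedy step. Since `d` is the least key, it bounds the open labels from below; since
  -- `b ≤ d`, it bounds the settled ones from above. All edges out of `u` become pending.
  settle : ∀ {u d} → Invariant settled b (λ _ _ _ → ⊥) q labels →
    keyOf q u ≡ just d → (∀ v {y} → keyOf q v ≡ just y → ¬ (y < d)) →
    (∀ v → keyOf q′ v ≡ (keyOf q [ u ]≔ nothing) v) →
    settled u ≡ false × (∃ λ P → labels u ≡ just (d , P)) ×
    Invariant (settled [ u ]≔ true) d (λ v _ _ → u ≡ v) q′ labels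
  settle {settled} {b} {q} {labels} {q′} {u} {d} inv ku minimal keys =
    u-open , (P , lu) , record
    { settled-key   = λ v v-settled → trans (keys v) (key v (now-settled v v-settled))
    ; settled-label = λ v v-settled → case-settled v (now-settled v v-settled)
    ; open-key      = λ v v-open → let (u≢v , v-open′) = now-open v v-open in
        trans (keys v) (trans (update-other (keyOf q) {u} nothing u≢v) (inv .open-key v v-open′))
    ; open-label    = λ v v-open lv → ≮⇒≥ (minimal v
        (trans (inv .open-key v (proj₂ (now-open v v-open))) (cong (Maybe.map proj₁) lv)))
    ; label-weight  = inv .label-weight
    ; relaxed       = λ v v-settled lv joins → Sum.map₂
        (λ v-settled′ → Sum.[ ⊥-elim , (λ r → r) ]′ (inv .relaxed v v-settled′ lv joins))
        (now-settled v v-settled)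
    ; source        = inv .source
    }
    where
    now-settled : ∀ v → (settled [ u ]≔ true) v ≡ true → u ≡ v ⊎ settled v ≡ true
    now-settled = update-elim settled u true (λ v c → c ≡ true → u ≡ v ⊎ settled v ≡ true)
      (λ _ → inj₁ refl) (λ _ _ → inj₂)
    now-open : ∀ v → (settled [ u ]≔ true) v ≡ false → u ≢ v × settled v ≡ false
    now-open = update-elim settled u true (λ v c → c ≡ false → u ≢ v × settled v ≡ false)
      (λ ()) (λ _ u≢v v-open → u≢v , v-open)
    unsettled : ∀ {c} → settled u ≡ c → c ≡ false
    unsettled {false} _  = refl
    unsettled {true}  eq with trans (sym ku) (inv .settled-key u eq)
    ... | ()
    u-open : settled u ≡ false
    u-open = unsettled refl
    labelled : ∀ l → Maybe.map proj₁ l ≡ just d → ∃ λ P → l ≡ just (d , P)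
    labelled (just (_ , P)) refl = P , refl
    lu′ : ∃ λ P → labels u ≡ just (d , P)
    lu′ = labelled (labels u) (trans (sym (inv .open-key u u-open)) ku)
    P = proj₁ lu′
    lu = proj₂ lu′
    key : ∀ v → u ≡ v ⊎ settled v ≡ true → (keyOf q [ u ]≔ nothing) v ≡ nothing
    key v (inj₁ refl)      = update-same (keyOf q) u nothing
    key v (inj₂ v-settled) = update-elim (keyOf q) u nothing (λ v k → keyOf q v ≡ nothing → k ≡ nothing)
      (λ _ → refl) (λ _ _ eq → eq) v (inv .settled-key v v-settled)
    case-settled : ∀ v → u ≡ v ⊎ settled v ≡ true → Reached labels v d
    case-settled v (inj₁ refl)      = d , P , lu , ≤-refl
    case-settled v (inj₂ v-settled) with inv .settled-label v v-settled
    ... | y , Q , lv , y≤b = y , Q , lv , ≤-trans y≤b (inv .open-label u u-open lu)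

  -- The pending edges are those still listed in `es`. The label of `u` does not change during the
  -- scan, so the `d` and `P` read before it stay current.
  Scanning : (Fin n → Bool) → ∀ {u} → Carrier → Path G s u → List (Incident G u) → State → Set _
  Scanning settled {u} d P es (q , labels) =
    Invariant settled d (λ x e v → u ≡ x × Any (Is e v) es) q labels ×
    labels u ≡ just (d , P) × settled u ≡ true

  -- A settled vertex is never improved, as its label is at most `d` and `d ≤ d + w e`. So an
  -- improved `v` is open, its key agrees with its label, and the heap operation meets its
  -- precondition. The 6 counts the unit steps of the longest branch, that of `decreaseKey`.
  relax-spec : ∀ {u d} {P : Path G s u} i es st → Scanning settled d P (i ∷ es) st →
    let r = relax w d P st i in
    Scanning settled d P es (value r) ×
    time r ℕ.+ Φ (proj₁ (value r)) ℕ.≤ Φ (proj₁ st) ℕ.+ (6 ℕ.+ C)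
  relax-spec {settled} {u} {d} {P} (e , v , uv) es (q , labels) (inv , lu , u-settled) = cases
    where
    x = d + w e
    Q = P ▷ (e , uv)
    d≤x : d ≤ x
    d≤x = x≤x+y d (0≤w e)
    x≡wQ : x ≡ weight F w Q
    x≡wQ = cong (_+ w e) (inv .label-weight u lu)
    open-if : ∀ {c} → settled v ≡ c →
      (Reached labels v d → ⊥) → c ≡ false
    open-if {false} _  _ = refl
    open-if {true}  eq f = ⊥-elim (f (inv .settled-label v eq))
    improved : ∀ {q′} → settled v ≡ false →
      (∀ {y Q′} → labels v ≡ just (y , Q′) → x ≤ y) →
      (∀ z → keyOf q′ z ≡ (keyOf q [ v ]≔ just x) z) →
      Scanning settled d P es (q′ , labels [ v ]≔ just (x , Q))
    improved v-open x≤ keys = discharge inv′ still-pending , lu′ , u-settled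
      where
      inv′ = improve inv v-open d≤x x≡wQ x≤ keys
      lu′ : (labels [ v ]≔ just (x , Q)) u ≡ just (d , P)
      lu′ = trans (update-other labels {v} (just (x , Q)) v≢u) lu
        where
        v≢u : v ≢ u
        v≢u refl with trans (sym u-settled) v-open
        ... | ()
      still-pending : ∀ z {y R} → (labels [ v ]≔ just (x , Q)) z ≡ just (y , R) →
        ∀ {e′ v′} → Joins G e′ z v′ → u ≡ z × Any (Is e′ v′) ((e , v , uv) ∷ es) →
        (u ≡ z × Any (Is e′ v′) es) ⊎ Reached (labels [ v ]≔ just (x , Q)) v′ (y + w e′)
      still-pending _ lz _ (refl , there i∈) = inj₁ (refl , i∈)
      -- The label of `u` is still `d`, so the required bound `y + w e′` is the new label `x`
      -- itself.
      still-pending _ lz _ (refl , here (refl , refl)) with trans (sym lz) lu′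
      ... | refl = inj₂ (x , Q , update-same labels v (just (x , Q)) , ≤-refl)
    kept : ∀ {y R} → labels v ≡ just (y , R) → y ≤ x → Scanning settled d P es (q , labels)
    kept lv y≤x = discharge inv still-pending , lu , u-settled
      where
      still-pending : ∀ z {y R} → labels z ≡ just (y , R) →
        ∀ {e′ v′} → Joins G e′ z v′ → u ≡ z × Any (Is e′ v′) ((e , v , uv) ∷ es) →
        (u ≡ z × Any (Is e′ v′) es) ⊎ Reached labels v′ (y + w e′)
      still-pending _ lz _ (refl , there i∈) = inj₁ (refl , i∈)
      still-pending _ lz _ (refl , here (refl , refl)) with trans (sym lz) lu
      ... | refl = inj₂ (_ , _ , lv , y≤x)
    -- Here `k` unit steps precede the heap operation, and the 0 is the closing `return`.
    cost : ∀ k t {φ} → k ℕ.≤ 6 → t ℕ.+ φ ℕ.≤ Φ q ℕ.+ C →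
      k ℕ.+ (t ℕ.+ 0) ℕ.+ φ ℕ.≤ Φ q ℕ.+ (6 ℕ.+ C)
    cost k t k≤6 t≤ rewrite ℕₚ.+-identityʳ t =
      ℕₚ.≤-trans (amortise-steps k t (Φ q) t≤) (ℕₚ.+-monoʳ-≤ (Φ q) (ℕₚ.+-monoˡ-≤ C k≤6))
    cases : let r = relax w d P (q , labels) (e , v , uv) in
      Scanning settled d P es (value r) ×
      time r ℕ.+ Φ (proj₁ (value r)) ℕ.≤ Φ q ℕ.+ (6 ℕ.+ C)
    cases with labels v in lv
    ... | nothing = improved v-open none (insert-spec v x q kv) ,
                    cost 5 (time (insert v x q)) (ℕₚ.n≤1+n 5) (insert-cost v x q kv)
      where
      none : ∀ {y Q′} → labels v ≡ just (y , Q′) → x ≤ y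
      none eq with trans (sym lv) eq
      ... | ()
      v-open : settled v ≡ false
      v-open = open-if refl λ (_ , _ , eq , _) → ⊥-elim (absurd (trans (sym lv) eq))
        where
        absurd : ∀ {l : Carrier × Path G s v} → nothing ≡ just l → ⊥
        absurd ()
      kv : keyOf q v ≡ nothing
      kv = trans (inv .open-key v v-open) (cong (Maybe.map proj₁) lv)
    ... | just (y , R) with x <? y
    ...   | no x≮y = kept lv (≮⇒≥ x≮y) ,
                     ℕₚ.≤-trans (ℕₚ.≤-reflexive (ℕₚ.+-comm 4 (Φ q)))
                       (ℕₚ.+-monoʳ-≤ (Φ q) (s≤s (s≤s (s≤s (s≤s z≤n)))))
    ...   | yes x<y = improved v-open below (decreaseKey-spec v x q kv x<y) ,
                      cost 6 (time (decreaseKey v x q)) ℕₚ.≤-refl (decreaseKey-cost v x q kv x<y)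
      where
      below : ∀ {z Q′} → labels v ≡ just (z , Q′) → x ≤ z
      below eq with trans (sym lv) eq
      ... | refl = inj₁ x<y
      v-open : settled v ≡ false
      v-open = open-if refl λ (z , _ , eq , z≤d) →
        <⇒≱ x<y (≤-trans (subst (_≤ d) (cong proj₁ (just-injective (trans (sym eq) lv))) z≤d) d≤x)
      kv : keyOf q v ≡ just y
      kv = trans (inv .open-key v v-open) (cong (Maybe.map proj₁) lv)

  -- Together these make every stored path shortest. The equation is propositional because `relax`
  -- adds weights in the same order as `weight`.
  ShortestLabels : Array Label → Set _
  ShortestLabels labels =
    (∀ {t} (P : Path G s t) → Reached labels t (weight F w P)) ×
    (∀ t {y Q} → labels t ≡ just (y , Q) → y ≡ weight F w Q)

  -- Induction along the path: the end of a prefix is labelled, hence settled, and with nothing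
  -- pending the next edge has been relaxed.
  all-settled : Invariant settled b (λ _ _ _ → ⊥) q labels →
    (∀ v {l} → labels v ≡ just l → settled v ≡ true) → ShortestLabels labels
  all-settled {labels = labels} inv all = reach , λ t → inv .label-weight t
    where
    reach : ∀ {t} (P : Path G s t) → Reached labels t (weight F w P)
    reach [] = inv .source
    reach (_▷_ {u} P (e , uv)) with reach P
    ... | y , Q , lu , y≤ with inv .relaxed u (all u lu) lu uv
    ... | inj₂ (z , R , lv , z≤) = z , R , lv , ≤-trans z≤ (+-monoˡ-≤ (w e) y≤)

  -- Extraction is followed by two reads, of the label and of the adjacency list; relaxation pays 6
  -- steps, the iteration and one heap operation.
  extractCost relaxCost : ℕ
  extractCost = C ℕ.* suc ⌊log₂ n ⌋ ℕ.+ 2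
  relaxCost = 7 ℕ.+ C

  module _ (adj : Adj) (complete : Complete adj) where

    degree : Fin n → ℕ
    degree u = length (adj u)

    -- The fuel equals the number of open vertices, so running out of it means that all are settled.
    -- Settling `u` uses one unit of fuel and takes the degree of `u` off the relaxations still to
    -- be paid for.
    loop-spec : ∀ fuel settled {b q labels} → Invariant settled b (λ _ _ _ → ⊥) q labels →
      remaining settled (λ _ → 1) ≡ fuel →
      let r = loop fuel w adj (q , labels) in
      ShortestLabels (value r) ×
      time r ℕ.≤ Φ q ℕ.+ (fuel ℕ.* extractCost ℕ.+ remaining settled degree ℕ.* relaxCost)
    loop-spec zero settled inv none =
      all-settled inv (λ v _ → remaining≡0 settled none v) , z≤n
    loop-spec (suc fuel) settled {b} {q} {labels} inv left
      with value (extractMin q) in eq | extractMin-cost q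
    ... | nothing | cost = all-settled inv all , bound
      where
      -- A labelled open vertex would have a key, but the heap is empty.
      all : ∀ v {l} → labels v ≡ just l → settled v ≡ true
      all v lv with settled v in v-settled
      ... | true  = refl
      ... | false with trans (sym (extractMin-nothing q eq v))
                         (trans (inv .open-key v v-settled) (cong (Maybe.map proj₁) lv))
      ... | ()
      t = time (extractMin q)
      R = remaining settled degree ℕ.* relaxCost
      bound : t ℕ.+ 1 ℕ.≤ Φ q ℕ.+ (suc fuel ℕ.* extractCost ℕ.+ R)
      -- A failed extraction leaves the potential at `Φ q`, which is added on both sides so that
      -- `amortise` applies.
      bound = ℕₚ.+-cancelʳ-≤ (Φ q) _ _ (begin
        (t ℕ.+ 1) ℕ.+ Φ q                           ≤⟨ amortise t 1 (Φ q) {Φ q} cost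
                                                         (ℕₚ.≤-reflexive (ℕₚ.+-comm 1 (Φ q))) ⟩
        Φ q ℕ.+ (C ℕ.* suc ⌊log₂ n ⌋ ℕ.+ 1)         ≤⟨ ℕₚ.+-monoʳ-≤ (Φ q) (ℕₚ.+-monoʳ-≤ _ (ℕₚ.n≤1+n 1)) ⟩
        Φ q ℕ.+ extractCost                         ≤⟨ ℕₚ.+-monoʳ-≤ (Φ q)
          (ℕₚ.≤-trans (ℕₚ.m≤m+n extractCost _) (ℕₚ.m≤m+n (suc fuel ℕ.* extractCost) R)) ⟩
        Φ q ℕ.+ (suc fuel ℕ.* extractCost ℕ.+ R)    ≤⟨ ℕₚ.m≤m+n _ (Φ q) ⟩
        Φ q ℕ.+ (suc fuel ℕ.* extractCost ℕ.+ R) ℕ.+ Φ q ∎)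
        where open ℕₚ.≤-Reasoning
    ... | just (u , q′) | cost with extractMin-just q eq
    ... | (d , ku , minimal) , keys with settle {q′ = q′} inv ku minimal keys
    ... | u-open , (P , lu) , inv′
      with for-rule (Scanning (settled [ u ]≔ true) d P) (λ st → Φ (proj₁ st)) (6 ℕ.+ C) (relax w d P)
             relax-spec (adj u) (q′ , labels)
             -- By completeness every pending edge has an entry in `adj u`; once the list is used
             -- up, nothing is pending.
             ( discharge inv′ (λ { _ _ joins refl → inj₁ (refl , complete joins) })
             , lu , update-same settled u true )
    ... | (inv″ , _) , for-cost
      with loop-spec fuel (settled [ u ]≔ true)
             (discharge inv″ (λ { _ _ _ (_ , ()) }))
             (ℕₚ.suc-injective (trans (sym (remaining-settle settled (λ _ → 1) u-open)) left))
    -- Rewriting by `lu` selects the branch of `loop` in which the extracted vertex has a label.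
    ... | shortest , loop-cost rewrite lu = shortest , (begin
      tₑ ℕ.+ (2 ℕ.+ (tₛ ℕ.+ tₗ))      ≡⟨ ℕₚ.+-identityʳ _ ⟨
      tₑ ℕ.+ (2 ℕ.+ (tₛ ℕ.+ tₗ)) ℕ.+ 0
        ≤⟨ amortise tₑ (2 ℕ.+ (tₛ ℕ.+ tₗ)) (Φ q) cost
             (amortise-steps 2 (tₛ ℕ.+ tₗ) (Φ q′)
               (amortise tₛ tₗ (Φ q′) for-cost (ℕₚ.≤-trans (ℕₚ.≤-reflexive (ℕₚ.+-identityʳ tₗ)) loop-cost))) ⟩
      Φ q ℕ.+ (E ℕ.+ (2 ℕ.+ (D ℕ.* relaxCost ℕ.+ (fuel ℕ.* extractCost ℕ.+ R ℕ.* relaxCost))))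
        ≡⟨ cong (Φ q ℕ.+_) (solve 5 (λ e d k f r →
             e :+ (con 2 :+ (d :* k :+ (f :+ r :* k))) := ((e :+ con 2) :+ f) :+ (d :+ r) :* k)
             refl E D relaxCost (fuel ℕ.* extractCost) R) ⟩
      Φ q ℕ.+ (suc fuel ℕ.* extractCost ℕ.+ (D ℕ.+ R) ℕ.* relaxCost)
        ≡⟨ cong (λ r → Φ q ℕ.+ (suc fuel ℕ.* extractCost ℕ.+ r ℕ.* relaxCost))
             (remaining-settle settled degree u-open) ⟨
      Φ q ℕ.+ (suc fuel ℕ.* extractCost ℕ.+ remaining settled degree ℕ.* relaxCost) ∎)
      where
      open ℕₚ.≤-Reasoning
      open +-*-Solver
      scan = for adj u from (q′ , labels) do′ relax w d P
      tₑ = time (extractMin q)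
      tₛ = time scan
      tₗ = time (loop fuel w adj (value scan))
      E = C ℕ.* suc ⌊log₂ n ⌋
      D = degree u
      R = remaining (settled [ u ]≔ true) degree

    dijkstra-spec : let r = dijkstra w adj in
      ShortestLabels (value r) ×
      time r ℕ.≤ n ℕ.+ 1 ℕ.+ (C ℕ.* suc n ℕ.+ (C ℕ.+ (n ℕ.* extractCost ℕ.+ degreeSum adj ℕ.* relaxCost)))
    dijkstra-spec = proj₁ looped , (begin
      n ℕ.+ suc (t₀ ℕ.+ (t₁ ℕ.+ t₂))            ≡⟨ ℕₚ.+-assoc n 1 _ ⟨
      n ℕ.+ 1 ℕ.+ (t₀ ℕ.+ (t₁ ℕ.+ t₂))          ≡⟨ cong (n ℕ.+ 1 ℕ.+_) (ℕₚ.+-identityʳ _) ⟨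
      -- The potential is 0 before the heap exists and is counted as 0 at the end.
      n ℕ.+ 1 ℕ.+ (t₀ ℕ.+ (t₁ ℕ.+ t₂) ℕ.+ 0)    ≤⟨ ℕₚ.+-monoʳ-≤ (n ℕ.+ 1)
        (amortise t₀ (t₁ ℕ.+ t₂) 0 (empty-cost n)
          (amortise t₁ t₂ (Φ q₀) (insert-cost s 0# q₀ (empty-spec s))
            (ℕₚ.≤-trans (ℕₚ.≤-reflexive (ℕₚ.+-identityʳ t₂)) (proj₂ looped)))) ⟩
      n ℕ.+ 1 ℕ.+ (C ℕ.* suc n ℕ.+ (C ℕ.+ (n ℕ.* extractCost ℕ.+ degreeSum adj ℕ.* relaxCost))) ∎)
      where
      open ℕₚ.≤-Reasoning
      q₀ = value empty
      q₁ = value (insert s 0# q₀)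
      none : Array Label
      none _ = nothing
      labels₀ : Array Label
      labels₀ = none [ s ]≔ just (0# , [])
      t₀ = time (empty {n})
      t₁ = time (insert s 0# q₀)
      t₂ = time (loop n w adj (q₁ , labels₀))
      initial : Invariant (λ _ → false) 0# (λ _ _ _ → ⊥) q₁ labels₀
      initial = record
        { settled-key   = λ _ ()
        ; settled-label = λ _ ()
        ; open-key      = λ v _ → trans (insert-spec s 0# q₀ (empty-spec s) v) (key v)
        ; open-label    = λ v _ → update-elim none s (just (0# , []))
            (λ v l → ∀ {y Q} → l ≡ just (y , Q) → 0# ≤ y) (λ { refl → ≤-refl }) (λ _ _ ()) v
        ; label-weight  = update-elim none s (just (0# , []))
            (λ v l → ∀ {y Q} → l ≡ just (y , Q) → y ≡ weight F w Q) (λ { refl → refl }) (λ _ _ ())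
        ; relaxed       = λ _ ()
        ; source        = 0# , [] , update-same none s (just (0# , [])) , ≤-refl
        }
        where
        key : ∀ v → (keyOf q₀ [ s ]≔ just 0#) v ≡ Maybe.map proj₁ (labels₀ v)
        key v with s ≟ v
        ... | yes refl = refl
        ... | no _     = empty-spec v
      -- With nothing settled there are `n` open vertices, and the remaining degrees add up to
      -- `degreeSum adj`.
      looped = loop-spec n (λ _ → false) initial (sum-ones n)

-- Path weights under concatenation and perturbation.

module PathWeight (F : OrderedField a ℓ₁ ℓ₂) {G : Graph n m} where

  open OrderedField F
  open OrderedFieldProperties F
  open Reasoning

  weight-edge : ∀ (w : Fin m → Carrier) {u v} (e : ∃ λ e → Joins G e u v) →
    weight F {G = G} w (edge e) ≈ w (proj₁ e)
  weight-edge w e = +-identityˡ _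

  weight-∘ : ∀ (w : Fin m → Carrier) {u v t} (P : Path G u v) (Q : Path G v t) →
    weight F w (P ∘ Q) ≈ weight F w P + weight F w Q
  weight-∘ w P []            = ≈-sym (+-identityʳ _)
  weight-∘ w P (Q ▷ (e , _)) = begin-equality
    weight F w (P ∘ Q) + w e                ≈⟨ +-congʳ (weight-∘ w P Q) ⟩
    (weight F w P + weight F w Q) + w e     ≈⟨ +-assoc _ _ _ ⟩
    weight F w P + (weight F w Q + w e)     ∎

  weight-detour : ∀ (w : Fin m → Carrier) {u v x y}
    (e₁ : ∃ λ e → Joins G e u v) (P : Path G v x) (e₂ : ∃ λ e → Joins G e x y) →
    weight F w (edge e₁ ∘ P ∘ edge e₂) ≈ w (proj₁ e₁) + weight F w P + w (proj₁ e₂)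
  weight-detour w e₁ P e₂ = +-congʳ (≈-trans (weight-∘ w (edge e₁) P) (+-congʳ (weight-edge w e₁)))

  -- Writing the surcharge of an edge as `c * δ`, with `c` 0 or 1, lets gray and other edges share
  -- one induction step.
  weight-perturbed : ∀ (gray : Subset m) {δ} {w w′ : Fin m → Carrier} →
    (∀ e → w′ e ≡ (if lookup gray e then w e + δ else w e)) →
    ∀ {u v} (P : Path G u v) →
    weight F w′ P ≈ weight F w P + fromℕ (grayEdges gray P) * δ
  weight-perturbed gray {δ} w′≡ [] = ≈-sym (≈-trans (+-identityˡ _) (zeroˡ δ))
  weight-perturbed gray {δ} {w} {w′} w′≡ (P ▷ (e , _)) = begin-equality
    weight F w′ P + w′ e
      ≈⟨ +-cong (weight-perturbed gray w′≡ P) (≈-reflexive (w′≡ e)) ⟩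
    (weight F w P + fromℕ k * δ) + _
      ≈⟨ +-congˡ (one-edge (lookup gray e)) ⟩
    (weight F w P + fromℕ k * δ) + (w e + fromℕ c * δ)
      ≈⟨ solve 5 (λ x k d y c → (x :+ k :* d) :+ (y :+ c :* d) := (x :+ y) :+ (k :+ c) :* d)
           ≈-refl (weight F w P) (fromℕ k) δ (w e) (fromℕ c) ⟩
    (weight F w P + w e) + (fromℕ k + fromℕ c) * δ
      ≈⟨ +-congˡ (*-congʳ (fromℕ-+ k c)) ⟨
    (weight F w P + w e) + fromℕ (k ℕ.+ c) * δ              ∎
    where
    open Solver
    k = grayEdges gray P
    c = if lookup gray e then 1 else 0
    one-edge : ∀ b → (if b then w e + δ else w e) ≈ w e + fromℕ (if b then 1 else 0) * δ
    one-edge true  = +-congˡ (≈-sym (≈-trans (*-congʳ (+-identityʳ 1#)) (*-identityˡ δ)))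
    one-edge false = ≈-sym (≈-trans (+-congˡ (zeroˡ δ)) (+-identityʳ _))

-- Undirectedness, by which the end edges of a g-short path can be walked backwards.
swap : {G : Graph n m} {u v : Fin n} → (∃ λ e → Joins G e u v) → ∃ λ e → Joins G e v u
swap (e , uv) = e , Sum.swap uv

-- The procedure: its guarantee and its running time.

module Correctness (F : OrderedField a ℓ₁ ℓ₂) (H : FibonacciHeap F h) (I : Instance F n m) where

  open OrderedField F
  open OrderedFieldProperties F
  open FibonacciHeap H using (C)
  open Instance I
  open Preprocessing F I
  open PathWeight F {G = G}
  open Adjacency G using (Complete; buildAdjacency-spec; degreeSum)

  -- `δ₀` is the formula of `δ` free of its positivity arguments, so that it is defined for graphs
  -- without edges too.
  W̅ δ₀ : Carrier
  W̅ = value (maxWeight F I)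
  δ₀ = (ε * W̅) * fromℕ g ⁻¹

  w≤W̅ : ∀ e → w e ≤ W̅
  w≤W̅ = proj₁ maxWeight-spec

  w′ : Fin m → Carrier
  w′ = value (perturbedWeights F I δ₀)

  w′≡ : ∀ e → w′ e ≡ perturb δ₀ e
  w′≡ = proj₁ (perturbedWeights-spec δ₀)

  -- An edge is needed only to know that W̅, and hence δ₀, is positive.
  0<W̅ : Fin m → 0# < W̅
  0<W̅ e = Reasoning.begin-strict
    0#   Reasoning.<⟨ 0<w e ⟩
    w e  Reasoning.≤⟨ w≤W̅ e ⟩
    W̅    Reasoning.∎

  -- The edge `e` is itself the witness that makes `δ₀` positive.
  0≤w′ : ∀ e → 0# ≤ w′ e
  0≤w′ e rewrite w′≡ e with lookup gray e
  ... | false = inj₁ (0<w e)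
  ... | true  = ≤-trans (inj₁ (0<w e)) (x≤x+y (w e) (inj₁ (0<δ 0<ε (0<W̅ e) 0<g)))

  open DijkstraCorrectness F H G s w′ 0≤w′ using (ShortestLabels; dijkstra-spec; extractCost; relaxCost)

  adj = value (buildAdjacency G)

  labels = value (Dijkstra.dijkstra F H G s w′ adj)

  labels-spec : ShortestLabels labels
  labels-spec = proj₁ (dijkstra-spec adj (proj₁ buildAdjacency-spec))

  -- The g-short path serves three times: it shows that `t` is labelled, its edge `e₁` makes `W̅`
  -- and `δ₀` positive, and its form bounds the gray edges of `P`.
  solves : SolvesWeakCSSSPWithError F I (value (procedure F I H))
  solves t (.(edge e₁ ∘ π ∘ edge e₂) , gray<g , s′ , t′ , e₁ , π , e₂ , shortest , refl)
    with proj₁ labels-spec {t} (edge e₁ ∘ π ∘ edge e₂)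
  ... | d , P , lt , _ = P , cong (Maybe.map proj₂) lt , few-gray , light
    where
    open Reasoning
    δ>0 : 0# < δ₀
    δ>0 = 0<δ 0<ε (0<W̅ (proj₁ e₁)) 0<g
    k = grayEdges gray P

    minimal : ∀ Q → weight F w P + fromℕ k * δ₀ ≤ weight F w Q + fromℕ (grayEdges gray Q) * δ₀
    minimal Q with proj₁ labels-spec Q
    ... | y , R , lt′ , y≤ with trans (sym lt) lt′
    ... | refl = begin
      weight F w P + fromℕ k * δ₀                          ≈⟨ weight-perturbed gray w′≡ P ⟨
      weight F w′ P                                        ≡⟨ proj₂ labels-spec t lt ⟨
      y                                                    ≤⟨ y≤ ⟩
      weight F w′ Q                                        ≈⟨ weight-perturbed gray w′≡ Q ⟩
      weight F w Q + fromℕ (grayEdges gray Q) * δ₀         ∎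

    light′ : ∀ Q → grayEdges gray Q ℕ.< g →
      weight F w P + fromℕ k * δ₀ < weight F w Q + ε * W̅
    light′ Q q<g = begin-strict
      weight F w P + fromℕ k * δ₀                          ≤⟨ minimal Q ⟩
      weight F w Q + fromℕ (grayEdges gray Q) * δ₀
        <⟨ +-monoʳ-< _ (kδ<εW̅ 0<ε (0<W̅ (proj₁ e₁)) 0<g q<g) ⟩
      weight F w Q + ε * W̅                                 ∎

    light : ∀ Q → grayEdges gray Q ℕ.< g → weight F w P < weight F w Q + ε * W
    light Q q<g = begin-strict
      weight F w P                     ≈⟨ +-identityʳ _ ⟨
      weight F w P + 0#                ≈⟨ +-congˡ (zeroˡ δ₀) ⟨
      weight F w P + 0# * δ₀           ≤⟨ +-monoʳ-≤ _ (*-monoˡ-≤ δ>0 (fromℕ-nonneg k)) ⟩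
      weight F w P + fromℕ k * δ₀      <⟨ light′ Q q<g ⟩
      weight F w Q + ε * W̅             ≤⟨ +-monoʳ-≤ _ εW̅≤εW ⟩
      weight F w Q + ε * W             ∎
      where
      εW̅≤εW : ε * W̅ ≤ ε * W
      εW̅≤εW = begin
        ε * W̅  ≈⟨ *-comm ε W̅ ⟩
        W̅ * ε  ≤⟨ *-monoˡ-≤ 0<ε (proj₁ (proj₂ maxWeight-spec)) ⟩
        W * ε  ≈⟨ *-comm W ε ⟩
        ε * W  ∎

    -- The five copies of `W̅` bound the two end edges of the g-short path, the same two edges in
    -- the detour through `P`, and `ε * W̅`.
    gray-weight : fromℕ k * δ₀ ≤ fromℕ 5 * W̅
    gray-weight = +-cancelˡ-≤ (weight F w P) (begin
      weight F w P + fromℕ k * δ₀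
        <⟨ light′ (edge e₁ ∘ π ∘ edge e₂) gray<g ⟩
      weight F w (edge e₁ ∘ π ∘ edge e₂) + ε * W̅
        ≈⟨ +-congʳ (weight-detour w e₁ π e₂) ⟩
      ((w (proj₁ e₁) + weight F w π) + w (proj₁ e₂)) + ε * W̅
        ≤⟨ +-mono-≤ (+-mono-≤ (+-mono-≤ (w≤W̅ _) (shortest (edge (swap e₁) ∘ P ∘ edge (swap e₂)))) (w≤W̅ _))
             (inj₁ (<-respʳ-≈ (*-identityˡ W̅) (*-monoˡ-< (0<W̅ (proj₁ e₁)) ε<1))) ⟩
      ((W̅ + weight F w (edge (swap e₁) ∘ P ∘ edge (swap e₂))) + W̅) + W̅
        ≈⟨ +-congʳ (+-congʳ (+-congˡ (weight-detour w (swap e₁) P (swap e₂)))) ⟩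
      ((W̅ + ((w (proj₁ e₁) + weight F w P) + w (proj₁ e₂))) + W̅) + W̅
        ≤⟨ +-monoˡ-≤ _ (+-monoˡ-≤ _ (+-monoʳ-≤ _ (+-mono-≤ (+-monoˡ-≤ _ (w≤W̅ _)) (w≤W̅ _)))) ⟩
      ((W̅ + ((W̅ + weight F w P) + W̅)) + W̅) + W̅
        -- The coefficient is written out as `fromℕ 5` unfolds.
        ≈⟨ solve 2 (λ x p → ((x :+ ((x :+ p) :+ x)) :+ x) :+ x :=
             p :+ (con 1 :+ (con 1 :+ (con 1 :+ (con 1 :+ (con 1 :+ con 0))))) :* x)
             ≈-refl W̅ (weight F w P) ⟩
      weight F w P + fromℕ 5 * W̅ ∎)
      where open Solver

    few-gray : fromℕ k ≤ fromℕ (5 ℕ.* g) * ε ⁻¹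
    few-gray = kδ≤5W̅⇒k≤5g/ε 0<ε (0<W̅ (proj₁ e₁)) 0<g k gray-weight

  -- From `2 ≤ n` the logarithm is at least 1, so `n * L` absorbs the linear and the constant terms.
  -- The coefficients are then `29 + 2C` for `m` and `9 + 5C` for `n * L`.
  procedure-time : 2 ℕ.≤ n →
    time (procedure F I H) ℕ.≤ (29 ℕ.+ 5 ℕ.* C) ℕ.* (m ℕ.+ n ℕ.* ⌊log₂ n ⌋)
  procedure-time 2≤n = begin
    -- The 3 counts the operations that compute `δ₀`, the last `n` the output array.
    t₁ ℕ.+ (3 ℕ.+ (t₂ ℕ.+ (t₃ ℕ.+ (t₄ ℕ.+ n))))
      ≤⟨ ℕₚ.+-mono-≤ (proj₂ (proj₂ maxWeight-spec)) (ℕₚ.+-monoʳ-≤ 3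
           (ℕₚ.+-mono-≤ (proj₂ (perturbedWeights-spec δ₀))
             (ℕₚ.+-mono-≤ (proj₂ (proj₂ buildAdjacency-spec))
               (ℕₚ.+-monoˡ-≤ _ (proj₂ (dijkstra-spec adj (proj₁ buildAdjacency-spec))))))) ⟩
    bound (degreeSum adj)
      ≡⟨ cong bound (proj₁ (proj₂ buildAdjacency-spec)) ⟩
    bound (2 ℕ.* m)
      ≡⟨ solve 4 (λ m n c l →
           m :* con 3 :+ (con 3 :+ ((m :+ m :* con 5) :+ ((n :+ m :* con 6) :+
             ((n :+ con 1 :+ (c :* (con 1 :+ n) :+ (c :+ (n :* (c :* (con 1 :+ l) :+ con 2) :+
               (con 2 :* m) :* (con 7 :+ c))))) :+ n))))
           := m :* (con 29 :+ con 2 :* c) :+ n :* l :* c :+ n :* (con 5 :+ con 2 :* c)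
              :+ (con 4 :+ con 2 :* c)) refl m n C L ⟩
    m ℕ.* (29 ℕ.+ 2 ℕ.* C) ℕ.+ n ℕ.* L ℕ.* C ℕ.+ n ℕ.* (5 ℕ.+ 2 ℕ.* C) ℕ.+ (4 ℕ.+ 2 ℕ.* C)
      ≤⟨ ℕₚ.+-mono-≤ (ℕₚ.+-monoʳ-≤ (m ℕ.* (29 ℕ.+ 2 ℕ.* C) ℕ.+ n ℕ.* L ℕ.* C)
           (ℕₚ.*-monoˡ-≤ (5 ℕ.+ 2 ℕ.* C) n≤nL))
           (ℕₚ.≤-trans (ℕₚ.≤-reflexive (sym (ℕₚ.*-identityˡ (4 ℕ.+ 2 ℕ.* C))))
             (ℕₚ.*-monoˡ-≤ (4 ℕ.+ 2 ℕ.* C) (ℕₚ.≤-trans (ℕₚ.<⇒≤ 2≤n) n≤nL))) ⟩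
    m ℕ.* (29 ℕ.+ 2 ℕ.* C) ℕ.+ n ℕ.* L ℕ.* C ℕ.+ n ℕ.* L ℕ.* (5 ℕ.+ 2 ℕ.* C) ℕ.+ n ℕ.* L ℕ.* (4 ℕ.+ 2 ℕ.* C)
      -- The slack raises both coefficients to `29 + 5C`.
      ≤⟨ ℕₚ.m≤m+n _ (m ℕ.* (3 ℕ.* C) ℕ.+ n ℕ.* L ℕ.* 20) ⟩
    m ℕ.* (29 ℕ.+ 2 ℕ.* C) ℕ.+ n ℕ.* L ℕ.* C ℕ.+ n ℕ.* L ℕ.* (5 ℕ.+ 2 ℕ.* C) ℕ.+ n ℕ.* L ℕ.* (4 ℕ.+ 2 ℕ.* C)
      ℕ.+ (m ℕ.* (3 ℕ.* C) ℕ.+ n ℕ.* L ℕ.* 20)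
      ≡⟨ solve 3 (λ m x c →
           m :* (con 29 :+ con 2 :* c) :+ x :* c :+ x :* (con 5 :+ con 2 :* c) :+ x :* (con 4 :+ con 2 :* c)
             :+ (m :* (con 3 :* c) :+ x :* con 20)
           := (con 29 :+ con 5 :* c) :* (m :+ x)) refl m (n ℕ.* L) C ⟩
    (29 ℕ.+ 5 ℕ.* C) ℕ.* (m ℕ.+ n ℕ.* L) ∎
    where
    open ℕₚ.≤-Reasoning
    open +-*-Solver
    L = ⌊log₂ n ⌋
    n≤nL : n ℕ.≤ n ℕ.* L
    n≤nL = ℕₚ.≤-trans (ℕₚ.≤-reflexive (sym (ℕₚ.*-identityʳ n))) (ℕₚ.*-monoʳ-≤ n (⌊log₂⌋-mono-≤ 2≤n))
    t₁ = time (maxWeight F I)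
    t₂ = time (perturbedWeights F I δ₀)
    t₃ = time (buildAdjacency G)
    t₄ = time (Dijkstra.dijkstra F H G s w′ adj)
    bound : ℕ → ℕ
    bound d = m ℕ.* 3 ℕ.+ (3 ℕ.+ ((m ℕ.+ m ℕ.* 5) ℕ.+ ((n ℕ.+ m ℕ.* 6) ℕ.+
      ((n ℕ.+ 1 ℕ.+ (C ℕ.* suc n ℕ.+ (C ℕ.+ (n ℕ.* extractCost ℕ.+ d ℕ.* relaxCost)))) ℕ.+ n))))

open import Data.Nat using (_+_; _*_; _≤_)

theorem10 : ∀ {a ℓ₁ ℓ₂ h : Level} (F : OrderedField a ℓ₁ ℓ₂) (H : FibonacciHeap F h) →
    (∃₂ λ (c n₀ : ℕ) → ∀ (n m : ℕ) (I : Instance F n m) → n₀ ≤ n →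
    time (procedure F I H) ≤ c * (m + n * ⌊log₂ n ⌋))
    × (∀ (n m : ℕ) (I : Instance F n m) →
    SolvesWeakCSSSPWithError F I (value (procedure F I H)))
theorem10 F H =
  (29 ℕ.+ 5 ℕ.* FibonacciHeap.C H , 2 , λ _ _ I → Correctness.procedure-time F H I) ,
  λ _ _ I → Correctness.solves F H I
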